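{- Let $a,b\ge1$ be integers. The cube coefficients $c_k(\Pi^{a,b}_n)$ of the Horadam cubes satisfy, for all $n\ge2$ and $k\ge0$, $$c_k(\Pi^{a,b}_n)=a\,c_k(\Pi^{a,b}_{n-1})+b\,c_k(\Pi^{a,b}_{n-2})+(a-1)\,c_{k-1}(\Pi^{a,b}_{n-1})+b\,c_{k-1}(\Pi^{a,b}_{n-2}),$$ where $c_{ -1}:=0$, with initial values $c_0(\Pi^{a,b}_n)=s^{a,b}_n$ for $n\ge 0$ and $c_1(\Pi^{a,b}_1)=a-1$. Furthermore, their generating function $A(x,y)=\sum_{n\ge0,\,k\ge0}c_k(\Pi^{a,b}_n)x^ny^k$ is $$A(x,y)=\frac{1}{1-ax-bx^2-(a-1)xy-bx^2y}.$$
   Context: For integers $a,b\ge1$ and $n\ge 0$, $\mathcal S^{a,b}_n$ is the set of all strings of length $n$ over the alphabet $\{0,1,\dots,a+b-1\}$ in which every letter from $\{a,\dots,a+b-1\}$ appears only immediately after a letter $0$; $\mathcal S^{a,b}_0$ contains only the empty string. The Horadam cube $\Pi^{a,b}_n$ is the simple graph with vertex set $\mathcal S^{a,b}_n$ in which $x_1\cdots x_n$ and $y_1\cdots y_n$ are adjacent if and only if $\sum_{i=1}^n|x_i-y_i|=1$. $s^{a,b}_n=|\mathcal S^{a,b}_n|$, so $s^{a,b}_0=1$, $s^{a,b}_1=a$, $s^{a,b}_n=as^{a,b}_{n-1}+bs^{a,b}_{n-2}$ for $n\ge2$. For a graph $G$ and $k\ge0$, the cube coefficient $c_k(G)$ is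 the number of induced subgraphs of $G$ isomorphic to the $k$-dimensional hypercube $Q_k$ (so $c_0(G)=|V(G)|$, $c_1(G)=|E(G)|$). The generating function is a formal power series. -}

module Defs where

open import Data.Bool.Base using (Bool; true; false)
open import Data.Empty.Irrelevant using (⊥-elim)
open import Data.Fin.Base using (Fin; zero; suc; toℕ)
open import Data.Fin.Properties using (all?; any?; 2↔Bool; *↔×)
import Data.Fin.Properties as Fin
open import Data.Fin.Subset using (Subset; _∈_)
open import Data.Fin.Subset.Properties using (_∈?_)
open import Data.Integer.Base as ℤ using (ℤ; +_; 0ℤ)
import Data.Integer.Properties as ℤ
open import Data.Irrelevant using ([_])
open import Data.Nat.Base using (ℕ; zero; suc; _+_; _*_; _∸_; _≤_; ∣_-_∣)
import Data.Nat.Properties as ℕ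
open import Data.Product.Base using (∃; _×_; _,_; proj₁; proj₂)
open import Data.Product.Function.NonDependent.Propositional using (_×-↔_)
open import Data.Refinement using (Refinement-syntax; _,_; value; value-injective)
open import Data.Vec.Base using (Vec; []; _∷_; lookup; tabulate; sum; zipWith)
open import Data.Vec.Properties using (lookup∘tabulate)
open import Function.Base using (_∘_; _on_)
open import Function.Bundles using (_↔_; _⇔_; mk↔ₛ′; mk⇔; Inverse; Equivalence)
open import Function.Construct.Composition using (_↔-∘_)
open import Function.Construct.Symmetry using (↔-sym)
open import Relation.Binary.Core using (Rel)
import Relation.Binary.Definitions as B
open import Relation.Binary.PropositionalEquality
  using (_≡_; refl; sym; trans; cong; cong₂; subst; subst₂)
open import Relation.Nullary.Decidable using (Dec; yes; no; map′; _×-dec_; _→-dec_)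
open import Relation.Unary using (Pred; Decidable)

open import Algebra.Properties.Monoid.Sum ℤ.+-0-monoid using (sum⁺-syntax)
open import Level using (0ℓ)

open Inverse using (to; from; strictlyInverseˡ; strictlyInverseʳ)

record Finite (A : Set) : Set where
  field
    size  : ℕ
    index : A ↔ Fin size

open Finite

private variable
  A : Set
  m n : ℕ

Fin-finite : ∀ n → Finite (Fin n)
Fin-finite n = record { size = n ; index = mk↔ₛ′ (λ i → i) (λ i → i) (λ _ → refl) (λ _ → refl) }

Bool-finite : Finite Bool
Bool-finite = record { size = 2 ; index = ↔-sym 2↔Bool }

Vec-finite : Finite A → ∀ n → Finite (Vec A n)
Vec-finite F zero = record
  { size  = 1
  ; index = mk↔ₛ′ (λ _ → zero) (λ _ → []) (λ { zero → refl }) (λ { [] → refl })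
  }
Vec-finite F (suc n) = record
  { size  = size F * size (Vec-finite F n)
  ; index = ↔-sym *↔× ↔-∘ ((index F ×-↔ index (Vec-finite F n)) ↔-∘ uncons↔)
  }
  where
  uncons↔ : Vec _ (suc n) ↔ (_ × Vec _ n)
  uncons↔ = mk↔ₛ′ (λ { (x ∷ xs) → x , xs }) (λ { (x , xs) → x ∷ xs })
                  (λ _ → refl) (λ { (_ ∷ _) → refl })

private
  sub : ∀ n {P : Pred (Fin n) 0ℓ} → Decidable P → Finite [ i ∈ Fin n ∣ P i ]
  sub zero P? = record
    { size  = 0
    ; index = mk↔ₛ′ (λ { (() , _) }) (λ ()) (λ ()) (λ { (() , _) })
    }
  sub (suc n) {P} P? with P? zero | sub n {P ∘ suc} (P? ∘ suc)
  ... | yes p | F = record { size = suc (size F) ; index = mk↔ₛ′ f g f∘g g∘f }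
    where
    f : [ i ∈ Fin (suc n) ∣ P i ] → Fin (suc (size F))
    f (zero  , _) = zero
    f (suc i , q) = suc (to (index F) (i , q))
    lift : [ i ∈ Fin n ∣ P (suc i) ] → [ i ∈ Fin (suc n) ∣ P i ]
    lift (i , q) = suc i , q
    g : Fin (suc (size F)) → [ i ∈ Fin (suc n) ∣ P i ]
    g zero    = zero , [ p ]
    g (suc j) = lift (from (index F) j)
    f∘g : ∀ j → f (g j) ≡ j
    f∘g zero    = refl
    f∘g (suc j) = cong suc (strictlyInverseˡ (index F) j)
    g∘f : ∀ x → g (f x) ≡ x
    g∘f (zero  , _) = refl
    g∘f (suc i , q) = cong lift (strictlyInverseʳ (index F) (i , q))
  ... | no ¬p | F = record { size = size F ; index = mk↔ₛ′ f g f∘g g∘f }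
    where
    f : [ i ∈ Fin (suc n) ∣ P i ] → Fin (size F)
    f (zero  , [ q ]) = ⊥-elim (¬p q)
    f (suc i , q)     = to (index F) (i , q)
    lift : [ i ∈ Fin n ∣ P (suc i) ] → [ i ∈ Fin (suc n) ∣ P i ]
    lift (i , q) = suc i , q
    g : Fin (size F) → [ i ∈ Fin (suc n) ∣ P i ]
    g j = lift (from (index F) j)
    f∘g : ∀ j → f (g j) ≡ j
    f∘g j = strictlyInverseˡ (index F) j
    g∘f : ∀ x → g (f x) ≡ x
    g∘f (zero  , [ q ]) = ⊥-elim (¬p q)
    g∘f (suc i , q)     = cong lift (strictlyInverseʳ (index F) (i , q))

Refinement-finite : {P : Pred A 0ℓ} → Finite A → Decidable P → Finite [ x ∈ A ∣ P x ]
Refinement-finite {A} {P} F P? = record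
  { size  = size F′
  ; index = index F′ ↔-∘ mk↔ₛ′ f g (λ { (i , _) → value-injective (strictlyInverseˡ (index F) i) })
                                   (λ { (x , _) → value-injective (strictlyInverseʳ (index F) x) })
  }
  where
  F′ = sub (size F) (P? ∘ from (index F))
  f : [ x ∈ A ∣ P x ] → [ i ∈ Fin (size F) ∣ P (from (index F) i) ]
  f (x , [ p ]) = to (index F) x , [ subst P (sym (strictlyInverseʳ (index F) x)) p ]
  g : [ i ∈ Fin (size F) ∣ P (from (index F) i) ] → [ x ∈ A ∣ P x ]
  g (i , [ p ]) = from (index F) i , [ p ]

module _ (F : Finite A) {P : Pred A 0ℓ} (P? : Decidable P) where

  anyFinite? : Dec (∃ P)
  anyFinite? = map′ (λ { (i , p) → from (index F) i , p })
    (λ { (x , p) → to (index F) x , subst P (sym (strictlyInverseʳ (index F) x)) p })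
    (any? (P? ∘ from (index F)))

  allFinite? : Dec (∀ x → P x)
  allFinite? = map′ (λ p x → subst P (strictlyInverseʳ (index F) x) (p (to (index F) x)))
    (λ p i → p (from (index F) i))
    (all? (P? ∘ from (index F)))

≡-dec : Finite A → B.DecidableEquality A
≡-dec F x y = map′
  (λ e → trans (sym (strictlyInverseʳ (index F) x))
           (trans (cong (from (index F)) e) (strictlyInverseʳ (index F) y)))
  (cong (to (index F)))
  (to (index F) x Fin.≟ to (index F) y)

record Graph : Set₁ where
  field
    Vertex  : Set
    finite  : Finite Vertex
    Adj     : Rel Vertex 0ℓ
    adj?    : B.Decidable Adj
    adj-sym : B.Symmetric Adj
    adj-irr : B.Irreflexive _≡_ Adj

  order : ℕ
  order = size finite

open Graph

infix 4 _≅_ _≅?_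

record _≅_ (G H : Graph) : Set where
  field
    bij  : Vertex G ↔ Vertex H
    pres : ∀ u v → Adj G u v ⇔ Adj H (to bij u) (to bij v)

-- Maps between finite vertex sets are searched through their value tables.

_≅?_ : ∀ G H → Dec (G ≅ H)
G ≅? H = map′ fromTable toTable (anyFinite? (Vec-finite (finite H) (order G)) good?)
  where
  Table : Set
  Table = Vec (Vertex H) (order G)

  ix = index (finite G)

  ap : Table → Vertex G → Vertex H
  ap t u = lookup t (to ix u)

  Good : Table → Set
  Good t = (∀ u v → ap t u ≡ ap t v → u ≡ v)
         × (∀ w → ∃ λ u → ap t u ≡ w)
         × (∀ u v → (Adj G u v → Adj H (ap t u) (ap t v))
                  × (Adj H (ap t u) (ap t v) → Adj G u v))

  good? : Decidable Good
  good? t =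
    allG (λ u → allG λ v → ≡-dec (finite H) (ap t u) (ap t v) →-dec ≡-dec (finite G) u v)
    ×-dec allFinite? (finite H) (λ w → anyFinite? (finite G) λ u → ≡-dec (finite H) (ap t u) w)
    ×-dec allG (λ u → allG λ v → (adj? G u v →-dec adj? H _ _) ×-dec (adj? H _ _ →-dec adj? G u v))
    where
    allG : {P : Pred (Vertex G) 0ℓ} → Decidable P → Dec (∀ x → P x)
    allG = allFinite? (finite G)

  fromTable : ∃ Good → G ≅ H
  fromTable (t , inj , surj , adj) = record
    { bij  = mk↔ₛ′ (ap t) (proj₁ ∘ surj) (proj₂ ∘ surj) (λ u → inj _ _ (proj₂ (surj (ap t u))))
    ; pres = λ u v → mk⇔ (proj₁ (adj u v)) (proj₂ (adj u v))
    }

  toTable : G ≅ H → ∃ Good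
  toTable iso = t
    , (λ u v e → trans (sym (strictlyInverseʳ bij u)) (trans
         (cong (from bij) (trans (sym (ap≡ u)) (trans e (ap≡ v)))) (strictlyInverseʳ bij v)))
    , (λ w → from bij w , trans (ap≡ (from bij w)) (strictlyInverseˡ bij w))
    , (λ u v → (λ a → subst₂ (Adj H) (sym (ap≡ u)) (sym (ap≡ v)) (Equivalence.to (pres u v) a))
             , (λ a → Equivalence.from (pres u v) (subst₂ (Adj H) (ap≡ u) (ap≡ v) a)))
    where
    open _≅_ iso
    t : Table
    t = tabulate (to bij ∘ from ix)
    ap≡ : ∀ u → ap t u ≡ to bij u
    ap≡ u = trans (lookup∘tabulate _ (to ix u)) (cong (to bij) (strictlyInverseʳ ix u))

-- Vertex subsets are subsets of Fin (order G), through the indexing of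
-- the vertices; G ⟨ S ⟩ is the subgraph induced by S.

_⟨_⟩ : (G : Graph) → Subset (order G) → Graph
G ⟨ S ⟩ = record
  { Vertex  = [ v ∈ Vertex G ∣ to (index (finite G)) v ∈ S ]
  ; finite  = Refinement-finite (finite G) (λ v → to (index (finite G)) v ∈? S)
  ; Adj     = Adj G on value
  ; adj?    = λ u v → adj? G (value u) (value v)
  ; adj-sym = adj-sym G
  ; adj-irr = λ e → adj-irr G (cong value e)
  }

differ : Bool → Bool → ℕ
differ false false = 0
differ false true  = 1
differ true  false = 1
differ true  true  = 0

hamming : Vec Bool n → Vec Bool n → ℕ
hamming x y = sum (zipWith differ x y)

private
  hamming-sym : (x y : Vec Bool n) → hamming x y ≡ hamming y x
  hamming-sym []      []      = refl
  hamming-sym (x ∷ xs) (y ∷ ys) = cong₂ _+_ (differ-sym x y) (hamming-sym xs ys)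
    where
    differ-sym : ∀ x y → differ x y ≡ differ y x
    differ-sym false false = refl
    differ-sym false true  = refl
    differ-sym true  false = refl
    differ-sym true  true  = refl

  hamming-refl : (x : Vec Bool n) → hamming x x ≡ 0
  hamming-refl []           = refl
  hamming-refl (false ∷ xs) = hamming-refl xs
  hamming-refl (true  ∷ xs) = hamming-refl xs

Q : ℕ → Graph
Q k = record
  { Vertex  = Vec Bool k
  ; finite  = Vec-finite Bool-finite k
  ; Adj     = λ x y → hamming x y ≡ 1
  ; adj?    = λ x y → hamming x y ℕ.≟ 1
  ; adj-sym = λ {x} {y} e → trans (hamming-sym y x) e
  ; adj-irr = λ { {x} refl e → ℕ.0≢1+n (trans (sym (hamming-refl x)) e) }
  }

-- An induced subgraph is determined by its vertex set, so the induced
-- copies of Q k are counted as vertex subsets.  Refinement proofs are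
-- irrelevant: each subset counts once, however many isomorphisms it has.

cubes : ∀ k G → Finite [ S ∈ Subset (order G) ∣ G ⟨ S ⟩ ≅ Q k ]
cubes k G = Refinement-finite (Vec-finite Bool-finite (order G)) (λ S → G ⟨ S ⟩ ≅? Q k)

c : ℕ → Graph → ℕ
c k G = size (cubes k G)

-- c₋₁ k is c (k - 1), with the convention that c (-1) vanishes.

c₋₁ : ℕ → Graph → ℕ
c₋₁ zero    G = 0
c₋₁ (suc k) G = c k G

Admissible : ∀ a {b n} → Vec (Fin (a + b)) n → Set
Admissible a {n = n} x = (i : Fin n) → a ≤ toℕ (lookup x i) →
  ∃ λ (j : Fin n) → suc (toℕ j) ≡ toℕ i × toℕ (lookup x j) ≡ 0

admissible? : ∀ a {b n} → Decidable (Admissible a {b} {n})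
admissible? a x = all? λ i → (a ℕ.≤? toℕ (lookup x i)) →-dec
  any? λ j → (suc (toℕ j) ℕ.≟ toℕ i) ×-dec (toℕ (lookup x j) ℕ.≟ 0)

𝒮 : ℕ → ℕ → ℕ → Set
𝒮 a b n = [ x ∈ Vec (Fin (a + b)) n ∣ Admissible a x ]

𝒮-finite : ∀ a b n → Finite (𝒮 a b n)
𝒮-finite a b n = Refinement-finite (Vec-finite (Fin-finite (a + b)) n) (admissible? a)

s : ℕ → ℕ → ℕ → ℕ
s a b n = size (𝒮-finite a b n)

distance : Vec (Fin m) n → Vec (Fin m) n → ℕ
distance x y = sum (zipWith (λ p q → ∣ toℕ p - toℕ q ∣) x y)

private
  distance-sym : (x y : Vec (Fin m) n) → distance x y ≡ distance y x
  distance-sym []       []       = refl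
  distance-sym (x ∷ xs) (y ∷ ys) =
    cong₂ _+_ (ℕ.∣-∣-comm (toℕ x) (toℕ y)) (distance-sym xs ys)

  distance-refl : (x : Vec (Fin m) n) → distance x x ≡ 0
  distance-refl []       = refl
  distance-refl (x ∷ xs) = cong₂ _+_ (ℕ.∣n-n∣≡0 (toℕ x)) (distance-refl xs)

Π : ℕ → ℕ → ℕ → Graph
Π a b n = record
  { Vertex  = 𝒮 a b n
  ; finite  = 𝒮-finite a b n
  ; Adj     = λ x y → distance (value x) (value y) ≡ 1
  ; adj?    = λ x y → distance (value x) (value y) ℕ.≟ 1
  ; adj-sym = λ {x} {y} e → trans (distance-sym (value y) (value x)) e
  ; adj-irr = λ { {x} refl e → ℕ.0≢1+n (trans (sym (distance-refl (value x))) e) }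
  }

-- f n k is the coefficient of xⁿyᵏ.

Series : Set
Series = ℕ → ℕ → ℤ

infix  4 _≈_
infixl 6 _⊖_
infixl 7 _⊗_

_≈_ : Series → Series → Set
f ≈ g = ∀ n k → f n k ≡ g n k

_⊖_ : Series → Series → Series
(f ⊖ g) n k = f n k ℤ.- g n k

_⊗_ : Series → Series → Series
(f ⊗ g) n k =
  ∑[ i ≤ n ] ∑[ j ≤ k ] (f (toℕ i) (toℕ j) ℤ.* g (n ∸ toℕ i) (k ∸ toℕ j))

-- monomial z i j is z xⁱ yʲ.

monomial : ℤ → ℕ → ℕ → Series
monomial z zero    zero    zero    zero    = z
monomial z (suc i) j       (suc n) k       = monomial z i j n k
monomial z zero    (suc j) zero    (suc k) = monomial z zero j zero k
monomial z _       _       _       _       = 0ℤ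

one : Series
one = monomial (+ 1) 0 0

cubeSeries : ℕ → ℕ → Series
cubeSeries a b n k = + c k (Π a b n)

-- A series A equals 1 / denominator a b when A ⊗ denominator a b ≈ one.

denominator : ℕ → ℕ → Series
denominator a b = one
  ⊖ monomial (+ a)         1 0
  ⊖ monomial (+ b)         2 0
  ⊖ monomial (+ a ℤ.- + 1) 1 1
  ⊖ monomial (+ b)         2 1

{-# OPTIONS --safe #-}

-- Every induced hypercube in a grid graph is a box: since opposite sides of a
-- 4-cycle change the same coordinate by the same amount, each coordinate of an
-- embedding of Q k is either constant or the image of one coordinate of Q k.
-- Hence the induced cubes of the Horadam cube are the products of letters and
-- of pairs of consecutive letters all of whose points are admissible.  Reading
-- such a box from the left, it starts with a letter i < a, with a pair
-- {i, i + 1} below a, with 0 followed by a letter ≥ a, or with 0 followed by a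
-- pair {i, i + 1} where i + 1 ≥ a; the remainder is again an arbitrary
-- admissible box.  These four cases are the four terms of the recurrence, which
-- together with the values at n ≤ 1 determines the product with the denominator.

module Submission where

open import Defs
open import Data.Bool.Base using (Bool; true; false; not; _xor_)
import Data.Bool.Properties as Bool
open import Data.Empty using (⊥)
open import Data.Fin.Base using (Fin; zero; suc; toℕ; inject₁; fromℕ<; splitAt; _↑ˡ_; _↑ʳ_)
open import Data.Fin.Permutation using (↔⇒≡)
import Data.Fin.Properties as Fin
open import Data.Fin.Subset using (Subset; _∈_)
open import Data.Fin.Subset.Properties using (_∈?_; ⊆-antisym)
open import Data.Integer.Base as ℤ using (ℤ; +_; 0ℤ; 1ℤ)
import Data.Integer.Properties as ℤ
open import Data.Integer.Tactic.RingSolver using (solve-∀)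
open import Data.Irrelevant using ([_])
open import Data.Nat.Base using (ℕ; zero; suc; _+_; _*_; _∸_; _≤_; _<_; _≥_; z≤n; s≤s; ∣_-_∣)
import Data.Nat.Properties as ℕ
open import Data.Product.Base using (∃; _×_; _,_; proj₁; proj₂)
open import Data.Product.Function.NonDependent.Propositional using (_×-↔_)
open import Data.Refinement using (Refinement-syntax; _,_; value; value-injective)
open import Data.Sum.Base as Sum using (_⊎_; inj₁; inj₂; [_,_]′)
open import Data.Sum.Function.Propositional using (_⊎-↔_)
open import Data.Vec.Base
  using (Vec; []; _∷_; head; tail; insertAt; removeAt; replicate; tabulate)
open import Data.Vec.Properties as Vec
  using (∷-injectiveˡ; ∷-injectiveʳ; removeAt-insertAt; lookup∘tabulate; []=⇒lookup; lookup⇒[]=)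
open import Function.Base using (_∘_; case_of_)
open import Function.Bundles using (_↔_; mk↔ₛ′; mk⇔; Inverse; Equivalence)
open import Function.Construct.Composition using (_↔-∘_)
open import Function.Construct.Identity using (↔-id)
open import Function.Construct.Symmetry using (↔-sym)
open import Relation.Binary.PropositionalEquality
  using (_≡_; _≢_; refl; sym; trans; cong; cong₂; subst; subst₂; module ≡-Reasoning)
open import Relation.Nullary.Decidable using (Dec; yes; no; does; dec-true; dec-false; recompute)
open import Relation.Nullary.Negation using (¬_; contradiction)
open import Algebra.Properties.Monoid.Sum ℤ.+-0-monoid using (sum; sum-cong-≗)

open Inverse using (to; from; strictlyInverseˡ; strictlyInverseʳ)

private variable
  k m n : ℕ

-- Edges and connectedness of the hypercube

infix 4 _~_

-- An inductive form of Hamming distance 1, on whose flipped position proofs can match instead of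
-- analysing a sum.
data _~_ : Vec Bool k → Vec Bool k → Set where
  here  : ∀ {b} {x : Vec Bool k} → b ∷ x ~ not b ∷ x
  there : ∀ {b} {x y : Vec Bool k} → x ~ y → b ∷ x ~ b ∷ y

origin : Vec Bool k
origin = replicate _ false

hamming-refl : (x : Vec Bool k) → hamming x x ≡ 0
hamming-refl []          = refl
hamming-refl (false ∷ x) = hamming-refl x
hamming-refl (true  ∷ x) = hamming-refl x

~⇒hamming : {x y : Vec Bool k} → x ~ y → hamming x y ≡ 1
~⇒hamming (here {b = false} {x}) = cong suc (hamming-refl x)
~⇒hamming (here {b = true}  {x}) = cong suc (hamming-refl x)
~⇒hamming (there {b = false} e)  = ~⇒hamming e
~⇒hamming (there {b = true}  e)  = ~⇒hamming e

-- Connectedness of the cube as an induction principle: the tail is corrected with the first bit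
-- held fixed, then the first bit is flipped if necessary.
~-connected : (P : Vec Bool k → Set) → (∀ {x y} → x ~ y → P x → P y) → ∀ x y → P x → P y
~-connected P step []      []       px = px
~-connected P step (b ∷ x) (b′ ∷ y) px = turn b b′ (~-connected (P ∘ (b ∷_)) (step ∘ there) x y px)
  where
  turn : ∀ b b′ → P (b ∷ y) → P (b′ ∷ y)
  turn false false p = p
  turn false true  p = step here p
  turn true  false p = step here p
  turn true  true  p = p

insertAt-~ : {x y : Vec Bool k} → ∀ d b → x ~ y → insertAt x d b ~ insertAt y d b
insertAt-~ zero    b e         = there e
insertAt-~ (suc d) b here      = here
insertAt-~ (suc d) b (there e) = there (insertAt-~ d b e)

insertAt-flip : (x : Vec Bool k) → ∀ d b → insertAt x d b ~ insertAt x d (not b)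
insertAt-flip x       zero    b = here
insertAt-flip (_ ∷ x) (suc d) b = there (insertAt-flip x d b)

insertAt-surjective : ∀ d (z : Vec Bool (suc k)) → ∃ λ b → ∃ λ x → insertAt x d b ≡ z
insertAt-surjective zero            (b ∷ x)     = b , x , refl
insertAt-surjective {suc _} (suc d) (c ∷ z) with insertAt-surjective d z
... | b , x , refl = b , c ∷ x , refl

-- Words as grid points: edges and 4-cycles

[]-unique : {A : Set} (v w : Vec A 0) → v ≡ w
[]-unique [] [] = refl

∷-η : {A : Set} (w : Vec A (suc n)) → head w ∷ tail w ≡ w
∷-η (_ ∷ _) = refl

distance-refl : (w : Vec (Fin m) n) → distance w w ≡ 0
distance-refl []      = refl
distance-refl (p ∷ w) = cong₂ _+_ (ℕ.∣n-n∣≡0 (toℕ p)) (distance-refl w)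

distance≡0⇒≡ : (v w : Vec (Fin m) n) → distance v w ≡ 0 → v ≡ w
distance≡0⇒≡ []      []      _ = refl
distance≡0⇒≡ (p ∷ v) (q ∷ w) e = cong₂ _∷_
  (Fin.toℕ-injective (ℕ.∣m-n∣≡0⇒m≡n (ℕ.m+n≡0⇒m≡0 ∣ toℕ p - toℕ q ∣ e)))
  (distance≡0⇒≡ v w (ℕ.m+n≡0⇒n≡0 ∣ toℕ p - toℕ q ∣ e))

Unit : ℕ → ℕ → Set
Unit p q = p ≡ suc q ⊎ q ≡ suc p

∣-∣≡1⇒Unit : ∀ p q → ∣ p - q ∣ ≡ 1 → Unit p q
∣-∣≡1⇒Unit zero    (suc q) refl = inj₂ refl
∣-∣≡1⇒Unit (suc p) zero    refl = inj₁ refl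
∣-∣≡1⇒Unit (suc p) (suc q) e with ∣-∣≡1⇒Unit p q e
... | inj₁ refl = inj₁ refl
... | inj₂ refl = inj₂ refl

-- A grid edge changes exactly one letter; matching on where it does so identifies everything that
-- stays fixed.
data Step : Vec (Fin m) (suc n) → Vec (Fin m) (suc n) → Set where
  inTail : ∀ {p : Fin m} {v w : Vec (Fin m) n} → distance v w ≡ 1 → Step (p ∷ v) (p ∷ w)
  inHead : ∀ {p q : Fin m} {w : Vec (Fin m) n} → Unit (toℕ p) (toℕ q) → Step (p ∷ w) (q ∷ w)

step : (v w : Vec (Fin m) (suc n)) → distance v w ≡ 1 → Step v w
step (p ∷ v) (q ∷ w) e with ∣ toℕ p - toℕ q ∣ in eq
step (p ∷ v) (q ∷ w) e | zero
  with refl ← Fin.toℕ-injective {i = p} {q} (ℕ.∣m-n∣≡0⇒m≡n eq) = inTail e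
step (p ∷ v) (q ∷ w) e | suc zero
  with refl ← distance≡0⇒≡ v w (ℕ.suc-injective e) = inHead (∣-∣≡1⇒Unit (toℕ p) (toℕ q) eq)

¬distance-refl : (w : Vec (Fin m) n) → distance w w ≢ 1
¬distance-refl w e = ℕ.0≢1+n (trans (sym (distance-refl w)) e)

¬Unit-refl : ∀ p → ¬ Unit p p
¬Unit-refl p (inj₁ e) = ℕ.1+n≢n (sym e)
¬Unit-refl p (inj₂ e) = ℕ.1+n≢n (sym e)

-- A path contains no 4-cycle.

Unit-square : ∀ {p q r u} → Unit p q → Unit q u → Unit u r → Unit r p → q ≢ r → p ≡ u
Unit-square (inj₁ refl) (inj₁ refl) (inj₁ refl) (inj₁ ())   q≢r
Unit-square (inj₁ refl) (inj₁ refl) (inj₁ refl) (inj₂ ())   q≢r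
Unit-square (inj₁ refl) (inj₁ refl) (inj₂ refl) r~p         q≢r = contradiction refl q≢r
Unit-square (inj₁ refl) (inj₂ refl) u~r         r~p         q≢r = refl
Unit-square (inj₂ refl) (inj₁ refl) u~r         r~p         q≢r = refl
Unit-square (inj₂ refl) (inj₂ refl) (inj₁ refl) r~p         q≢r = contradiction refl q≢r
Unit-square (inj₂ refl) (inj₂ refl) (inj₂ refl) (inj₁ ())   q≢r
Unit-square (inj₂ refl) (inj₂ refl) (inj₂ refl) (inj₂ ())   q≢r

module _ {A B C D : Vec (Fin m) (suc n)} where

  -- Suppose that DC changes the first letter and AB does not. If neither BC nor AD changes it, then
  -- D and C agree in it after all; if exactly one does, a diagonal collapses; if both do, A and B
  -- have the same tail although AB changes it.
  square-parallel : Step A B → Step B C → Step D C → Step A D →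
                    A ≢ C → B ≢ D → head A ≡ head B → head D ≡ head C
  square-parallel _           _          (inTail _) _          _   _   _    = refl
  square-parallel (inTail _)  (inTail _) (inHead dc) (inTail _) _  _   _    = contradiction dc (¬Unit-refl _)
  square-parallel (inTail _)  (inTail _) (inHead _) (inHead _) A≢C _   _    = contradiction refl A≢C
  square-parallel (inTail _)  (inHead _) (inHead _) (inTail _) _   B≢D _    = contradiction refl B≢D
  square-parallel (inTail {v = v} ab) (inHead _) (inHead _) (inHead _) _ _ _ = contradiction ab (¬distance-refl v)
  square-parallel (inHead pq) _          (inHead _) _          _   _   refl = contradiction pq (¬Unit-refl _)

  -- If both sides at A changed the first letter, A, B and D would share their tail. The sides at C
  -- would then change the first letter together, giving a 4-cycle in a path, or both keep it,
  -- forcing B = D; a mixture contradicts the common tail.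
  square-not-flat : Step A B → Step B C → Step D C → Step A D →
                    A ≢ C → B ≢ D → head A ≢ head D → head A ≡ head B
  square-not-flat (inTail _) _ _ _ _ _ _ = refl
  square-not-flat (inHead _) _ _ (inTail _) _ _ hA≢hD = contradiction refl hA≢hD
  square-not-flat (inHead _) (inTail _) (inTail _) (inHead _) _ B≢D _ = contradiction refl B≢D
  square-not-flat (inHead _) (inTail {v = v} bc) (inHead _) (inHead _) _ _ _ = contradiction bc (¬distance-refl v)
  square-not-flat (inHead _) (inHead _) (inTail {v = v} dc) (inHead _) _ _ _ = contradiction dc (¬distance-refl v)
  square-not-flat (inHead ab) (inHead bc) (inHead dc) (inHead ad) A≢C B≢D _ = contradiction
    (cong (_∷ _) (Fin.toℕ-injective
      (Unit-square ab bc (swap dc) (swap ad) (B≢D ∘ cong (_∷ _) ∘ Fin.toℕ-injective)))) A≢C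
    where
    swap : ∀ {p q} → Unit p q → Unit q p
    swap (inj₁ e) = inj₂ e
    swap (inj₂ e) = inj₁ e

-- Hypercubes embedded in a grid, seen through the first letter

record Embedding (φ : Vec Bool k → Vec (Fin m) n) : Set where
  field
    adjacent  : ∀ {x y} → x ~ y → distance (φ x) (φ y) ≡ 1
    -- Keeps the diagonals of the image of a square distinct, as the square lemmas demand.
    injective : ∀ {x y} → φ x ≡ φ y → x ≡ y

open Embedding

facet : {φ : Vec Bool (suc k) → Vec (Fin m) n} → Embedding φ → ∀ d b → Embedding (λ x → φ (insertAt x d b))
facet E d b = record
  { adjacent  = adjacent E ∘ insertAt-~ d b
  ; injective = λ {x} {y} e → trans (sym (removeAt-insertAt x d b))
             (trans (cong (λ z → removeAt z d) (injective E e)) (removeAt-insertAt y d b))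
  }

uncons : {φ : Vec Bool k → Vec (Fin m) (suc n)} {p : Fin m} {t : Vec Bool k → Vec (Fin m) n} →
         (∀ x → φ x ≡ p ∷ t x) → Embedding φ → Embedding t
uncons {p = p} {t} φ≡ E = record
  { adjacent  = λ {x} {y} e → trans (cong (_+ distance (t x) (t y)) (sym (ℕ.∣n-n∣≡0 (toℕ p))))
             (subst₂ (λ v w → distance v w ≡ 1) (φ≡ x) (φ≡ y) (adjacent E e))
  ; injective = λ {x} {y} e → injective E (trans (φ≡ x) (trans (cong (p ∷_) e) (sym (φ≡ y))))
  }

-- `along` splits off a factor: the `d`-th bit governs the first letter alone, the other bits govern
-- the rest of the word. This is what makes the image a product.
data FirstLetter {m n : ℕ} : {k : ℕ} → (Vec Bool k → Vec (Fin m) (suc n)) → Set where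
  constant : ∀ {k} {φ : Vec Bool k → _} p (t : Vec Bool k → Vec (Fin m) n) →
             (∀ x → φ x ≡ p ∷ t x) → FirstLetter φ
  along    : ∀ {k} {φ : Vec Bool (suc k) → _} d (p : Bool → Fin m) (t : Vec Bool k → Vec (Fin m) n) →
             (∀ x b → φ (insertAt x d b) ≡ p b ∷ t x) → FirstLetter φ

along-Unit : {φ : Vec Bool (suc k) → Vec (Fin m) (suc n)} → Embedding φ →
             ∀ d {p : Bool → Fin m} {t : Vec Bool k → Vec (Fin m) n} →
             (∀ x b → φ (insertAt x d b) ≡ p b ∷ t x) → Unit (toℕ (p false)) (toℕ (p true))
along-Unit {φ = φ} E d {p} {t} φ≡ = ∣-∣≡1⇒Unit _ _
  (trans (sym (ℕ.+-identityʳ _))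
    (trans (cong (λ d → ∣ toℕ (p false) - toℕ (p true) ∣ + d) (sym (distance-refl (t origin))))
      (subst₂ (λ v w → distance v w ≡ 1) (φ≡ origin false) (φ≡ origin true)
        (adjacent E (insertAt-flip origin d false)))))

module _ {φ : Vec Bool (suc k) → Vec (Fin m) (suc n)} (E : Embedding φ) where

  private
    S : ∀ {x y} → x ~ y → Step (φ x) (φ y)
    S e = step _ _ (adjacent E e)

    opposite : ∀ b {x y} → φ (b ∷ x) ≢ φ (not b ∷ y)
    opposite false q with () ← injective E q
    opposite true  q with () ← injective E q

  turn-parallel : ∀ {x y} b → x ~ y →
                  head (φ (b ∷ x)) ≡ head (φ (not b ∷ x)) → head (φ (b ∷ y)) ≡ head (φ (not b ∷ y))
  turn-parallel b e = square-parallel (S here) (S (there e)) (S here) (S (there e))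
    (opposite b) (opposite b ∘ sym)

  facet-flat : ∀ {x y} b → x ~ y → head (φ (b ∷ x)) ≢ head (φ (not b ∷ x)) →
               head (φ (b ∷ x)) ≡ head (φ (b ∷ y))
  facet-flat b e = square-not-flat (S (there e)) (S here) (S (there e)) (S here)
    (opposite b) (opposite b)

adjacent-tail : {φ : Vec Bool k → Vec (Fin m) (suc n)} → Embedding φ → ∀ {x y} → x ~ y →
                head (φ x) ≢ head (φ y) → tail (φ x) ≡ tail (φ y)
adjacent-tail {φ = φ} E {x} {y} x~y h≢ with φ x | φ y | step (φ x) (φ y) (adjacent E x~y)
... | _ | _ | inTail _ = contradiction refl h≢
... | _ | _ | inHead _ = refl

-- One edge in the direction of the first bit decides for all of them, by `turn-parallel` and
-- connectedness. If they keep the first letter, the answer for one facet extends to the whole cube.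
-- If they change it, `facet-flat` makes the first letter constant on each facet, and the two facets
-- share their tails.
firstLetter : {φ : Vec Bool k → Vec (Fin m) (suc n)} → Embedding φ → FirstLetter φ
firstLetter {k = zero} {φ = φ} E = constant (head (φ [])) (tail ∘ φ) λ { [] → sym (∷-η (φ [])) }
firstLetter {k = suc k} {φ = φ} E with head (φ (false ∷ origin)) Fin.≟ head (φ (true ∷ origin))
... | yes h≡ = extend (firstLetter (facet E zero false))
  where
  heads : ∀ x b → head (φ (b ∷ x)) ≡ head (φ (false ∷ x))
  heads x false = refl
  heads x true  = sym (~-connected (λ x → head (φ (false ∷ x)) ≡ head (φ (true ∷ x)))
                         (turn-parallel E false) origin x h≡)

  head≡ : ∀ {p : Fin _} {w} x b → φ (false ∷ x) ≡ p ∷ w → p ∷ tail (φ (b ∷ x)) ≡ φ (b ∷ x)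
  head≡ x b e = trans (cong (_∷ _) (sym (trans (heads x b) (cong head e)))) (∷-η (φ (b ∷ x)))

  extend : FirstLetter (φ ∘ (false ∷_)) → FirstLetter φ
  extend (constant p t φ≡) = constant p (tail ∘ φ) λ { (b ∷ x) → sym (head≡ x b (φ≡ x)) }
  extend (along d p t φ≡) = along (suc d) p (λ x → tail (φ (insertAt x (suc d) false)))
    λ { (c ∷ x) b → trans (sym (head≡ _ c (φ≡ x b))) (cong (p b ∷_) (tails c x b)) }
    where
    p≢ : p false ≢ p true
    p≢ e = ¬Unit-refl (toℕ (p false)) (subst (Unit (toℕ (p false)) ∘ toℕ) (sym e)
      (along-Unit (facet E zero false) d φ≡))

    -- The edge in direction `d` changes the first letter on either facet, since `p` takes two
    -- values; hence it keeps the tail.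
    tails : ∀ c x b → tail (φ (c ∷ insertAt x d b)) ≡ tail (φ (c ∷ insertAt x d false))
    tails c x false = refl
    tails c x true  = sym (adjacent-tail E (there (insertAt-flip x d false)) λ e →
      p≢ (trans (sym (head-φ false)) (trans e (head-φ true))))
      where
      head-φ : ∀ b → head (φ (c ∷ insertAt x d b)) ≡ p b
      head-φ b = trans (heads _ c) (cong head (φ≡ x b))
... | no  h≢ = along zero (λ b → head (φ (b ∷ origin))) (λ x → tail (φ (false ∷ x)))
    λ x b → trans (sym (∷-η _)) (cong₂ _∷_ (sym (flat b x)) (tails x b))
  where
  differ-everywhere : ∀ b x → head (φ (b ∷ x)) ≢ head (φ (not b ∷ x))
  differ-everywhere false x h≡ = h≢ (~-connected (λ x → head (φ (false ∷ x)) ≡ head (φ (true ∷ x)))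
                                      (turn-parallel E false) x origin h≡)
  differ-everywhere true  x h≡ = differ-everywhere false x (sym h≡)

  flat : ∀ b x → head (φ (b ∷ origin)) ≡ head (φ (b ∷ x))
  flat b x = ~-connected (λ x → head (φ (b ∷ origin)) ≡ head (φ (b ∷ x)))
    (λ {x} e h → trans h (facet-flat E b e (differ-everywhere b x))) origin x refl

  tails : ∀ x b → tail (φ (b ∷ x)) ≡ tail (φ (false ∷ x))
  tails x false = refl
  tails x true  = sym (adjacent-tail E here (differ-everywhere false x))

-- Boxes and the images of embeddings

data Box (m : ℕ) : ℕ → ℕ → Set where
  []     : Box m 0 0
  vertex : Fin (suc m) → Box m n k → Box m (suc n) k
  -- Over `suc m` letters there are `m` pairs of neighbours, numbered by their lower members.
  edge   : Fin m → Box m n k → Box m (suc n) (suc k)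

side : Fin m → Bool → Fin (suc m)
side e false = inject₁ e
side e true  = suc e

point : Box m n k → Vec Bool k → Vec (Fin (suc m)) n
point []           _       = []
point (vertex p B) z       = p ∷ point B z
point (edge e B)   (b ∷ z) = side e b ∷ point B z

-- Total on words: at an `edge`, every letter other than the upper one counts as `false`. A word
-- lies in the box exactly when `point` takes its coordinates back to it.
coordinates : Box m n k → Vec (Fin (suc m)) n → Vec Bool k
coordinates []           _       = []
coordinates (vertex _ B) (_ ∷ w) = coordinates B w
coordinates (edge e B)   (p ∷ w) = does (p Fin.≟ suc e) ∷ coordinates B w

inject₁≢suc : (e : Fin m) → inject₁ e ≢ suc e
inject₁≢suc (suc e) q = inject₁≢suc e (Fin.suc-injective q)

coordinates∘point : (B : Box m n k) → ∀ z → coordinates B (point B z) ≡ z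
coordinates∘point []           []          = refl
coordinates∘point (vertex _ B) z           = coordinates∘point B z
coordinates∘point (edge e B)   (false ∷ z) =
  cong₂ _∷_ (dec-false (inject₁ e Fin.≟ suc e) (inject₁≢suc e)) (coordinates∘point B z)
coordinates∘point (edge e B)   (true ∷ z)  =
  cong₂ _∷_ (dec-true (suc e Fin.≟ suc e) refl) (coordinates∘point B z)

point-isometric : (B : Box m n k) → ∀ y z → distance (point B y) (point B z) ≡ hamming y z
point-isometric []           []      []       = refl
point-isometric (vertex p B) y       z        =
  cong₂ _+_ (ℕ.∣n-n∣≡0 (toℕ p)) (point-isometric B y z)
point-isometric (edge e B)   (b ∷ y) (b′ ∷ z) = cong₂ _+_ (sides b b′) (point-isometric B y z)
  where
  sides : ∀ b b′ → ∣ toℕ (side e b) - toℕ (side e b′) ∣ ≡ differ b b′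
  sides false false = ℕ.∣n-n∣≡0 (toℕ (inject₁ e))
  sides true  true  = ℕ.∣n-n∣≡0 (toℕ e)
  sides false true  rewrite Fin.toℕ-inject₁ e = ∣n-1+n∣≡1 (toℕ e)
    where
    ∣n-1+n∣≡1 : ∀ n → ∣ n - suc n ∣ ≡ 1
    ∣n-1+n∣≡1 zero    = refl
    ∣n-1+n∣≡1 (suc n) = ∣n-1+n∣≡1 n
  sides true  false = trans (ℕ.∣-∣-comm (suc (toℕ e)) (toℕ (inject₁ e))) (sides false true)

infix 4 _⊑_

_⊑_ : {A X Y : Set} → (X → A) → (Y → A) → Set
f ⊑ g = ∀ x → ∃ λ y → g y ≡ f x

side-injective : ∀ {e e′ : Fin m} → side e ⊑ side e′ → e ≡ e′
side-injective {e = e} {e′} s with s false | s true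
... | false , p | _         = sym (Fin.inject₁-injective p)
... | true  , _ | true  , q = sym (Fin.suc-injective q)
-- Crossed sides would make each of `e` and `e′` the successor of the other.
... | true  , p | false , q = contradiction
  (trans (sym (Fin.toℕ-inject₁ e′)) (trans (cong toℕ q)
    (cong suc (trans (sym (Fin.toℕ-inject₁ e)) (cong toℕ (sym p))))))
  (ℕ.<⇒≢ (ℕ.m≤n+m _ 1))

-- The points show one letter at a `vertex` and two at an `edge`, so the constructors agree; since a
-- box is a product, the remaining positions can be compared with the first one held fixed.
box-unique : (B B′ : Box m n k) → point B ⊑ point B′ → point B′ ⊑ point B → B ≡ B′
box-unique []           []             _  _  = refl
box-unique (vertex p B) (vertex p′ B′) s  s′ = cong₂ vertex
  (sym (∷-injectiveˡ (proj₂ (s origin))))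
  (box-unique B B′ (λ z → proj₁ (s z) , ∷-injectiveʳ (proj₂ (s z)))
                   (λ z → proj₁ (s′ z) , ∷-injectiveʳ (proj₂ (s′ z))))
box-unique (vertex p B) (edge e B′)    s  s′ = contradiction
  (trans (sym (∷-injectiveˡ (proj₂ (s′ (false ∷ origin))))) (∷-injectiveˡ (proj₂ (s′ (true ∷ origin)))))
  (inject₁≢suc e)
box-unique (edge e B)   (vertex p B′)  s  s′ = contradiction
  (trans (sym (∷-injectiveˡ (proj₂ (s (false ∷ origin))))) (∷-injectiveˡ (proj₂ (s (true ∷ origin)))))
  (inject₁≢suc e)
box-unique (edge e B)   (edge e′ B′)   s  s′ =
  cong₂ edge (side-injective (sides s)) (box-unique B B′ (rest s) (rest s′))
  where
  sides : ∀ {e e′} {B B′ : Box _ _ _} → point (edge e B) ⊑ point (edge e′ B′) → side e ⊑ side e′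
  sides s b with s (b ∷ origin)
  ... | b′ ∷ _ , q = b′ , ∷-injectiveˡ q
  rest : ∀ {e e′} {B B′ : Box _ _ _} → point (edge e B) ⊑ point (edge e′ B′) → point B ⊑ point B′
  rest s z with s (false ∷ z)
  ... | _ ∷ z′ , q = z′ , ∷-injectiveʳ q

consecutive : (p q : Fin (suc m)) → toℕ q ≡ suc (toℕ p) → ∃ λ e → p ≡ inject₁ e × q ≡ suc e
consecutive p (suc e) q≡ =
  e , Fin.toℕ-injective (trans (sym (ℕ.suc-injective q≡)) (sym (Fin.toℕ-inject₁ e))) , refl

-- `σ` is the orientation: an embedding may run through its pair downwards, and the bit must then be
-- complemented.
Unit⇒side : (p : Bool → Fin (suc m)) → Unit (toℕ (p false)) (toℕ (p true)) →
            ∃ λ e → ∃ λ σ → ∀ b → p b ≡ side e (σ xor b)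
Unit⇒side p (inj₁ q) with e , q₀ , q₁ ← consecutive (p true) (p false) q =
  e , true , λ { false → q₁ ; true → q₀ }
Unit⇒side p (inj₂ q) with e , q₀ , q₁ ← consecutive (p false) (p true) q =
  e , false , λ { false → q₀ ; true → q₁ }

-- Induction on the length: `firstLetter` yields a letter or a pair, and what remains is an
-- embedding of the same cube or of a facet. Only images are compared, because an embedding may
-- permute and complement the bits.
box : ∀ n {φ : Vec Bool k → Vec (Fin (suc m)) n} → Embedding φ →
      ∃ λ (B : Box m n k) → point B ⊑ φ × φ ⊑ point B
box {k = zero}  zero E = [] , (λ { [] → [] , []-unique _ _ }) , λ { [] → [] , []-unique _ _ }
box {k = suc k} zero E with () ← injective E {false ∷ origin} {true ∷ origin} ([]-unique _ _)
box (suc n) E with firstLetter E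
... | constant p t φ≡ = case box n (uncons φ≡ E) of λ
  { (B , B⊑t , t⊑B) → vertex p B
                    , (λ z → proj₁ (B⊑t z) , trans (φ≡ _) (cong (p ∷_) (proj₂ (B⊑t z))))
                    , (λ x → proj₁ (t⊑B x) , trans (cong (p ∷_) (proj₂ (t⊑B x))) (sym (φ≡ x))) }
... | along {φ = φ} d p t φ≡
  with Unit⇒side p (along-Unit E d φ≡)
     | box n (uncons (λ x → φ≡ x false) (facet E d false))
... | e , σ , p≡ | B , B⊑t , t⊑B = edge e B , B⊑φ , φ⊑B
  where
  B⊑φ : point (edge e B) ⊑ φ
  B⊑φ (b ∷ z) with B⊑t z
  -- Complementing by `σ` here cancels the orientation contained in `p`.
  ... | x , q = insertAt x d (σ xor b) , trans (φ≡ _ _) (cong₂ _∷_ (trans (p≡ _) (cong (side e)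
     (trans (sym (Bool.xor-assoc σ σ b)) (cong (_xor b) (Bool.xor-same σ))))) q)
  φ⊑B : φ ⊑ point (edge e B)
  φ⊑B z with insertAt-surjective d z
  ... | b , x , refl = (σ xor b) ∷ proj₁ (t⊑B x)
      , trans (cong₂ _∷_ (sym (p≡ b)) (proj₂ (t⊑B x))) (sym (φ≡ x b))

-- Admissible words and admissible boxes

splitFin : ∀ m {n} (p : Fin (m + n)) → (∃ λ i → i ↑ˡ n ≡ p) ⊎ (∃ λ j → m ↑ʳ j ≡ p)
splitFin m p with splitAt m p in eq
... | inj₁ i = inj₁ (i , Fin.splitAt⁻¹-↑ˡ eq)
... | inj₂ j = inj₂ (j , Fin.splitAt⁻¹-↑ʳ {m} eq)

module Horadam (a⁻ b : ℕ) where

  private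
    Word : ℕ → Set
    Word n = Vec (Fin (suc a⁻ + b)) n

  Adm : Word n → Set
  Adm w = Admissible (suc a⁻) {b} w

  Adm? : (w : Word n) → Dec (Adm w)
  Adm? = admissible? (suc a⁻)

  Adm-[] : Adm []
  Adm-[] ()

  Adm-∷ : ∀ {p} {w : Word n} → toℕ p < suc a⁻ → Adm w → Adm (p ∷ w)
  Adm-∷ p<a A zero    a≤p = contradiction a≤p (ℕ.<⇒≱ p<a)
  Adm-∷ p<a A (suc i) a≤  with j , ij , z ← A i a≤ = suc j , cong suc ij , z

  Adm-0∷ : ∀ q {w : Word n} → Adm w → Adm (zero ∷ q ∷ w)
  Adm-0∷ q A (suc zero)    a≤q = zero , refl , refl
  Adm-0∷ q A (suc (suc i)) a≤  with j , ij , z ← A i a≤ = suc (suc j) , cong suc (cong suc ij) , z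

  Adm-head : ∀ {p} {w : Word n} → Adm (p ∷ w) → toℕ p < suc a⁻
  Adm-head A = ℕ.≰⇒> λ a≤p → case A zero a≤p of λ { (_ , () , _) }

  Adm-high : ∀ {p q} {w : Word n} → Adm (p ∷ q ∷ w) → suc a⁻ ≤ toℕ q → toℕ p ≡ 0
  Adm-high A a≤q with A (suc zero) a≤q
  ... | zero , _ , z = z

  -- Only `q` could owe its place to the dropped letter, and a letter below `a` may stand anywhere.
  Adm-tail : ∀ {p q} {w : Word n} → Adm (p ∷ q ∷ w) → toℕ q < suc a⁻ → Adm (q ∷ w)
  Adm-tail A q<a zero    a≤q = contradiction a≤q (ℕ.<⇒≱ q<a)
  Adm-tail A q<a (suc i) a≤  with A (suc (suc i)) a≤
  ... | suc j , ij , z = j , ℕ.suc-injective ij , z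

  Adm-tail-≢0 : ∀ {p} {w : Word n} → Adm (p ∷ w) → toℕ p ≢ 0 → Adm w
  Adm-tail-≢0 A p≢0 i a≤ with A (suc i) a≤
  ... | zero  , _  , z = contradiction z p≢0
  ... | suc j , ij , z = j , ℕ.suc-injective ij , z

  Adm-tail₂-≢0 : ∀ {p q} {w : Word n} → Adm (p ∷ q ∷ w) → toℕ q ≢ 0 → Adm w
  Adm-tail₂-≢0 A q≢0 i a≤ with A (suc (suc i)) a≤
  ... | suc zero    , _  , z = contradiction z q≢0
  ... | suc (suc j) , ij , z = j , ℕ.suc-injective (ℕ.suc-injective ij) , z

  -- The boxes all of whose points are admissible: a letter > a⁻ is
  -- preceded by a zero, and {a⁻ + j, suc a⁻ + j} may only follow a zero.

  data Code : ℕ → ℕ → Set where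
    []      : Code 0 0
    vertex  : Fin (suc a⁻) → Code n k → Code (suc n) k
    edge    : Fin a⁻ → Code n k → Code (suc n) (suc k)
    vertex₀ : Fin b → Code n k → Code (suc (suc n)) k
    edge₀   : Fin b → Code n k → Code (suc (suc n)) (suc k)

  toBox : Code n k → Box (a⁻ + b) n k
  toBox []            = []
  toBox (vertex i C)  = vertex (i ↑ˡ b) (toBox C)
  toBox (edge i C)    = edge (i ↑ˡ b) (toBox C)
  toBox (vertex₀ j C) = vertex zero (vertex (suc a⁻ ↑ʳ j) (toBox C))
  -- For `j = 0` the lower member of the pair is still below `a`; it is the upper one that calls for
  -- the zero.
  toBox (edge₀ j C)   = vertex zero (edge (a⁻ ↑ʳ j) (toBox C))

  low : ∀ (i : Fin m) → toℕ (i ↑ˡ b) < m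
  low i = subst (_< _) (sym (Fin.toℕ-↑ˡ i b)) (Fin.toℕ<n i)

  high : ∀ m (j : Fin b) → m ≤ toℕ (m ↑ʳ j)
  high m j = subst (m ≤_) (sym (Fin.toℕ-↑ʳ m j)) (ℕ.m≤m+n m (toℕ j))

  ↑ˡ≢↑ʳ : ∀ {i : Fin m} {j : Fin b} → i ↑ˡ b ≢ m ↑ʳ j
  ↑ˡ≢↑ʳ {m} {i} {j} e = ℕ.<⇒≱ (low i) (subst (λ p → m ≤ toℕ p) (sym e) (high m j))

  low-side : ∀ (i : Fin a⁻) σ → toℕ (side (i ↑ˡ b) σ) < suc a⁻
  low-side i true  = s≤s (low i)
  low-side i false = subst (_< suc a⁻) (sym (Fin.toℕ-inject₁ (i ↑ˡ b))) (ℕ.m<n⇒m<1+n (low i))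

  toBox-admissible : (C : Code n k) → ∀ z → Adm (point (toBox C) z)
  toBox-admissible []            []      = Adm-[]
  toBox-admissible (vertex i C)  z       = Adm-∷ (low i) (toBox-admissible C z)
  toBox-admissible (edge i C)    (σ ∷ z) = Adm-∷ (low-side i σ) (toBox-admissible C z)
  toBox-admissible (vertex₀ j C) z       = Adm-0∷ (suc a⁻ ↑ʳ j) (toBox-admissible C z)
  toBox-admissible (edge₀ j C)   (σ ∷ z) = Adm-0∷ (side (a⁻ ↑ʳ j) σ) (toBox-admissible C z)

  vertex-injective : ∀ {p q} {B B′ : Box m n k} → vertex p B ≡ vertex q B′ → p ≡ q × B ≡ B′
  vertex-injective refl = refl , refl

  edge-injective : ∀ {p q} {B B′ : Box m n k} → edge p B ≡ edge q B′ → p ≡ q × B ≡ B′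
  edge-injective refl = refl , refl

  -- No code begins with a letter that needs a zero before it. Hence a leading `zero` reads
  -- unambiguously: either as an entry of its own or as the licence of the next entry.
  toBox-vertex-low : (C : Code (suc n) k) → ∀ {j B} → toBox C ≢ vertex (suc a⁻ ↑ʳ j) B
  toBox-vertex-low (vertex i C)  e = ↑ˡ≢↑ʳ (proj₁ (vertex-injective e))
  toBox-vertex-low (vertex₀ _ _) e with () ← proj₁ (vertex-injective e)
  toBox-vertex-low (edge₀ _ _)   e with () ← proj₁ (vertex-injective e)

  toBox-edge-low : (C : Code (suc n) (suc k)) → ∀ {j B} → toBox C ≢ edge (a⁻ ↑ʳ j) B
  toBox-edge-low (edge i C) e = ↑ˡ≢↑ʳ (proj₁ (edge-injective e))

  toBox-injective : (C C′ : Code n k) → toBox C ≡ toBox C′ → C ≡ C′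
  toBox-injective [] [] _ = refl
  toBox-injective (vertex i C) (vertex i′ C′) e with p , q ← vertex-injective e =
    cong₂ vertex (Fin.↑ˡ-injective b i i′ p) (toBox-injective C C′ q)
  toBox-injective (vertex i C) (vertex₀ j C′) e =
    contradiction (proj₂ (vertex-injective e)) (toBox-vertex-low C)
  toBox-injective (vertex i C) (edge₀ j C′) e =
    contradiction (proj₂ (vertex-injective e)) (toBox-edge-low C)
  toBox-injective (edge i C) (edge i′ C′) e with p , q ← edge-injective e =
    cong₂ edge (Fin.↑ˡ-injective b i i′ p) (toBox-injective C C′ q)
  toBox-injective (vertex₀ j C) (vertex i C′) e =
    contradiction (sym (proj₂ (vertex-injective e))) (toBox-vertex-low C′)
  toBox-injective (vertex₀ j C) (vertex₀ j′ C′) e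
    with p , q ← vertex-injective (proj₂ (vertex-injective e)) =
    cong₂ vertex₀ (Fin.↑ʳ-injective (suc a⁻) j j′ p) (toBox-injective C C′ q)
  toBox-injective (edge₀ j C) (vertex i C′) e =
    contradiction (sym (proj₂ (vertex-injective e))) (toBox-edge-low C′)
  toBox-injective (edge₀ j C) (edge₀ j′ C′) e
    with p , q ← edge-injective (proj₂ (vertex-injective e)) =
    cong₂ edge₀ (Fin.↑ʳ-injective a⁻ j j′ p) (toBox-injective C C′ q)

  low-letter : ∀ (p : Fin (suc a⁻ + b)) → toℕ p < suc a⁻ → ∃ λ (i : Fin (suc a⁻)) → i ↑ˡ b ≡ p
  low-letter p p<a with splitFin (suc a⁻) p
  ... | inj₁ q          = q
  ... | inj₂ (j , refl) = contradiction (high (suc a⁻) j) (ℕ.<⇒≱ p<a)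

  Coded : Box (a⁻ + b) n k → Set
  Coded B = ∃ λ C → toBox C ≡ B

  Coded-vertex : ∀ {p} {B : Box (a⁻ + b) n k} → toℕ p < suc a⁻ → Coded B → Coded (vertex p B)
  Coded-vertex p<a (C , refl) with i , refl ← low-letter _ p<a = vertex i C , refl

  Coded-vertex₀ : ∀ {p q j} {B : Box (a⁻ + b) n k} → toℕ p ≡ 0 → suc a⁻ ↑ʳ j ≡ q →
                  Coded B → Coded (vertex p (vertex q B))
  Coded-vertex₀ {p = zero} {j = j} _ refl (C , refl) = vertex₀ j C , refl

  Coded-edge₀ : ∀ {p e j} {B : Box (a⁻ + b) n k} → toℕ p ≡ 0 → a⁻ ↑ʳ j ≡ e →
                Coded B → Coded (vertex p (edge e B))
  Coded-edge₀ {p = zero} {j = j} _ refl (C , refl) = edge₀ j C , refl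

  -- Two entries decide the constructor. If the second contains a letter that needs a zero, the
  -- first must be `zero` and both are consumed; otherwise only the first is, and the remainder is
  -- admissible by itself.
  toBox-surjective : (B : Box (a⁻ + b) n k) → (∀ z → Adm (point B z)) → Coded B
  toBox-surjective []            A = [] , refl
  toBox-surjective (vertex p []) A = Coded-vertex (Adm-head (A [])) ([] , refl)
  toBox-surjective (vertex p (vertex q B)) A =
    [ (λ (i , q≡) → Coded-vertex (Adm-head (A origin)) (toBox-surjective (vertex q B)
        λ z → Adm-tail (A z) (subst (λ q → toℕ q < suc a⁻) q≡ (low i))))
    , (λ (j , q≡) → let a≤q = subst (λ q → suc a⁻ ≤ toℕ q) q≡ (high (suc a⁻) j) in
        Coded-vertex₀ (Adm-high (A origin) a≤q) q≡ (toBox-surjective B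
          λ z → Adm-tail₂-≢0 (A z) (ℕ.>⇒≢ (ℕ.<-≤-trans (s≤s z≤n) a≤q))))
    ]′ (splitFin (suc a⁻) q)
  toBox-surjective (vertex p (edge e B)) A =
    [ (λ (i , e≡) → Coded-vertex (Adm-head (A origin)) (toBox-surjective (edge e B)
        λ { (σ ∷ z) → Adm-tail (A (σ ∷ z)) (subst (λ e → toℕ (side e σ) < suc a⁻) e≡ (low-side i σ)) }))
    , (λ (j , e≡) → Coded-edge₀
        (Adm-high (A (true ∷ origin)) (subst (λ e → suc a⁻ ≤ toℕ (side e true)) e≡ (high (suc a⁻) j))) e≡
        (toBox-surjective B λ z → Adm-tail₂-≢0 (A (true ∷ z)) λ ()))
    ]′ (splitFin a⁻ e)
  -- The upper member of a pair is nonzero, so the bit `true` shows the remainder admissible; in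
  -- first position it must be below `a`, which excludes the high pairs.
  toBox-surjective (edge e B) A with splitFin a⁻ e
  ... | inj₁ (i , refl)
    with C , refl ← toBox-surjective B (λ z → Adm-tail-≢0 (A (true ∷ z)) λ ()) = edge i C , refl
  ... | inj₂ (j , refl) = contradiction (high (suc a⁻) j) (ℕ.<⇒≱ (Adm-head (A (true ∷ origin))))

  -- Induced cubes correspond to codes

  module _ {n : ℕ} where

    private
      G : Graph
      G = Π (suc a⁻) b n

      ix : 𝒮 (suc a⁻) b n ↔ Fin (Graph.order G)
      ix = Finite.index (Graph.finite G)

      on? : (B : Box (a⁻ + b) n k) (w : Word n) → Dec (point B (coordinates B w) ≡ w)
      on? B w = Vec.≡-dec Fin._≟_ (point B (coordinates B w)) w

    region : Box (a⁻ + b) n k → Subset (Graph.order G)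
    region B = tabulate λ i → does (on? B (value (from ix i)))

    ∈-region⁺ : (B : Box (a⁻ + b) n k) (v : 𝒮 (suc a⁻) b n) → ∀ z →
                point B z ≡ value v → to ix v ∈ region B
    ∈-region⁺ B v z e = lookup⇒[]= _ _ (trans (lookup∘tabulate _ (to ix v))
      (dec-true (on? B _) (subst (λ v → point B (coordinates B (value v)) ≡ value v)
        (sym (strictlyInverseʳ ix v))
        (trans (cong (point B) (trans (cong (coordinates B) (sym e)) (coordinates∘point B z))) e))))

    ∈-region⁻ : (B : Box (a⁻ + b) n k) (v : 𝒮 (suc a⁻) b n) → to ix v ∈ region B →
                point B (coordinates B (value v)) ≡ value v
    ∈-region⁻ B v v∈ with on? B (value (from ix (to ix v))) in eq
    ... | yes e = subst (λ v → point B (coordinates B (value v)) ≡ value v) (strictlyInverseʳ ix v) e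
    ... | no _ with () ← trans (trans (sym ([]=⇒lookup v∈)) (lookup∘tabulate _ (to ix v))) (cong does eq)

    -- Admissibility makes every point of `B` a vertex of the graph, so passing to the region loses
    -- none.
    region-⊑ : (B B′ : Box (a⁻ + b) n k) → (∀ z → Adm (point B z)) →
               region B ≡ region B′ → point B ⊑ point B′
    region-⊑ B B′ A e z = _ , ∈-region⁻ B′ v (subst (to ix v ∈_) e (∈-region⁺ B v z refl))
      where
      v : 𝒮 (suc a⁻) b n
      v = point B z , [ A z ]

    region-injective : (C C′ : Code n k) → region (toBox C) ≡ region (toBox C′) → C ≡ C′
    region-injective C C′ e = toBox-injective C C′ (box-unique _ _
      (region-⊑ (toBox C) (toBox C′) (toBox-admissible C) e)
      (region-⊑ (toBox C′) (toBox C) (toBox-admissible C′) (sym e)))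

    -- `point` turns Hamming distance into grid distance, so adjacency is both preserved and
    -- reflected.
    region-cube : (C : Code n k) → G ⟨ region (toBox C) ⟩ ≅ Q k
    region-cube {k} C = record
      { bij  = mk↔ₛ′ coord pt (coordinates∘point B) λ u → value-injective (value-injective (pt∘coord u))
      ; pres = λ u v → mk⇔ (trans (sym (isometric u v))) (trans (isometric u v))
      }
      where
      B : Box (a⁻ + b) n k
      B = toBox C

      V : Set
      V = Graph.Vertex (G ⟨ region B ⟩)

      coord : V → Vec Bool k
      coord = coordinates B ∘ value ∘ value

      pt : Vec Bool k → V
      pt z = v , [ ∈-region⁺ B v z refl ]
        where
        v : 𝒮 (suc a⁻) b n
        v = point B z , [ toBox-admissible C z ]

      pt∘coord : (u : V) → point B (coord u) ≡ value (value u)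
      pt∘coord (v , [ v∈ ]) = recompute (on? B (value v)) (∈-region⁻ B v v∈)

      isometric : (u v : V) → distance (value (value u)) (value (value v)) ≡ hamming (coord u) (coord v)
      isometric u v = trans (sym (cong₂ distance (pt∘coord u) (pt∘coord v))) (point-isometric B _ _)

    module _ {k} {S : Subset (Graph.order G)} (iso : G ⟨ S ⟩ ≅ Q k) where

      open _≅_ iso

      private
        φ : Vec Bool k → Word n
        φ z = value (value (from bij z))

        φ-embedding : Embedding φ
        φ-embedding = record
          { adjacent  = λ {x} {y} e → Equivalence.from (pres _ _) (trans
              (cong₂ hamming (strictlyInverseˡ bij x) (strictlyInverseˡ bij y)) (~⇒hamming e))
          ; injective = λ {x} {y} e → trans (sym (strictlyInverseˡ bij x))
              (trans (cong (to bij) (value-injective (value-injective e))) (strictlyInverseˡ bij y))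
          }

        φ-admissible : ∀ z → Adm (φ z)
        φ-admissible z with (w , [ A ]) , _ ← from bij z = recompute (Adm? w) A

        φ-∈ : ∀ z → to ix (value (from bij z)) ∈ S
        φ-∈ z with v , [ v∈ ] ← from bij z = recompute (to ix v ∈? S) v∈

      -- The inverse isomorphism embeds the cube in the grid, so `S` consists of the points of a
      -- box. These are vertices, hence admissible, and the box comes from a code.
      cube-region : ∃ λ (C : Code n k) → region (toBox C) ≡ S
      cube-region with box n φ-embedding
      ... | B , B⊑φ , φ⊑B
        with C , refl ← toBox-surjective B (λ z → subst Adm (proj₂ (B⊑φ z)) (φ-admissible (proj₁ (B⊑φ z))))
        = C , ⊆-antisym (λ {i} → region⊆S {i}) (λ {i} → S⊆region {i})
        where
        region⊆S : ∀ {i} → i ∈ region B → i ∈ S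
        region⊆S {i} i∈ = subst (_∈ S) (trans (cong (to ix) v≡) (strictlyInverseˡ ix i)) (φ-∈ x)
          where
          x : Vec Bool k
          x = proj₁ (B⊑φ (coordinates B (value (from ix i))))
          v≡ : value (from bij x) ≡ from ix i
          v≡ = value-injective (trans (proj₂ (B⊑φ _))
            (∈-region⁻ B (from ix i) (subst (_∈ region B) (sym (strictlyInverseˡ ix i)) i∈)))

        S⊆region : ∀ {i} → i ∈ S → i ∈ region B
        S⊆region {i} i∈ = subst (_∈ region B) (strictlyInverseˡ ix i)
          (∈-region⁺ B (from ix i) (proj₁ (φ⊑B (to bij v)))
            (trans (proj₂ (φ⊑B (to bij v))) (cong (value ∘ value) (strictlyInverseʳ bij v))))
          where
          v : Graph.Vertex (G ⟨ S ⟩)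
          v = from ix i , [ subst (_∈ S) (sym (strictlyInverseˡ ix i)) i∈ ]

    Code↔cubes : Code n k ↔ [ S ∈ Subset (Graph.order G) ∣ G ⟨ S ⟩ ≅ Q k ]
    Code↔cubes {k} = mk↔ₛ′ f (proj₁ ∘ g) (λ S → value-injective (proj₂ (g S)))
      (λ C → region-injective _ C (proj₂ (g (f C))))
      where
      f : Code n k → [ S ∈ Subset (Graph.order G) ∣ G ⟨ S ⟩ ≅ Q k ]
      f C = region (toBox C) , [ region-cube C ]

      g : (S : [ S ∈ Subset (Graph.order G) ∣ G ⟨ S ⟩ ≅ Q k ]) →
          ∃ λ (C : Code n k) → region (toBox C) ≡ value S
      -- The isomorphism is irrelevant here; deciding `≅` again produces one that can be inspected.
      g (S , [ iso ]) = cube-region (recompute (G ⟨ S ⟩ ≅? Q k) iso)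

  Code↔Fin : ∀ n k → Code n k ↔ Fin (c k (Π (suc a⁻) b n))
  Code↔Fin n k = Finite.index (cubes k (Π (suc a⁻) b n)) ↔-∘ Code↔cubes

-- Counting codes: initial values and recurrence

vertices : Vec (Fin (suc m)) n → Box m n 0
vertices []      = []
vertices (p ∷ w) = vertex p (vertices w)

point∘vertices : (w : Vec (Fin (suc m)) n) → point (vertices w) [] ≡ w
point∘vertices []      = refl
point∘vertices (p ∷ w) = cong (p ∷_) (point∘vertices w)

vertices∘point : (B : Box m n 0) → vertices (point B []) ≡ B
vertices∘point []           = refl
vertices∘point (vertex p B) = cong (vertex p) (vertices∘point B)

-- Rewriting along this equation keeps the two counts of a concrete graph
-- from being compared by unfolding them.

c₋₁-suc : ∀ k G → c₋₁ (suc k) G ≡ c k G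
c₋₁-suc k G = refl

module Count (a⁻ b : ℕ) where

  open Horadam a⁻ b

  Code↔𝒮 : Code n 0 ↔ 𝒮 (suc a⁻) b n
  Code↔𝒮 {n} = mk↔ₛ′ f (proj₁ ∘ g)
    (λ w → value-injective (trans (cong (λ B → point B []) (proj₂ (g w))) (point∘vertices (value w))))
    (λ C → toBox-injective _ C (trans (proj₂ (g (f C))) (vertices∘point (toBox C))))
    where
    f : Code n 0 → 𝒮 (suc a⁻) b n
    f C = point (toBox C) [] , [ toBox-admissible C [] ]

    g : (w : 𝒮 (suc a⁻) b n) → ∃ λ C → toBox C ≡ vertices (value w)
    g (w , [ A ]) = toBox-surjective (vertices w)
      λ { [] → subst Adm (sym (point∘vertices w)) (recompute (Adm? w) A) }

  Code₋₁ : ℕ → ℕ → Set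
  Code₋₁ n zero    = ⊥
  Code₋₁ n (suc k) = Code n k

  Code₋₁↔Fin : ∀ n k → Code₋₁ n k ↔ Fin (c₋₁ k (Π (suc a⁻) b n))
  Code₋₁↔Fin n zero    = ↔-sym Fin.0↔⊥
  Code₋₁↔Fin n (suc k) =
    subst (λ N → Code n k ↔ Fin N) (sym (c₋₁-suc k (Π (suc a⁻) b n))) (Code↔Fin n k)

  Code-00 : Code 0 0 ↔ Fin 1
  Code-00 = mk↔ₛ′ (λ _ → zero) (λ _ → []) (λ { zero → refl }) λ { [] → refl }

  Code-0suc : Code 0 (suc k) ↔ Fin 0
  Code-0suc = mk↔ₛ′ (λ ()) (λ ()) (λ ()) λ ()

  -- The constructors that consume two letters have no room in length 1.
  Code-1 : ∀ k → Code 1 k ↔ (Fin (suc a⁻) × Code 0 k ⊎ Fin a⁻ × Code₋₁ 0 k)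
  Code-1 k = mk↔ₛ′ f (g k) (f∘g k) g∘f
    where
    f : ∀ {k} → Code 1 k → Fin (suc a⁻) × Code 0 k ⊎ Fin a⁻ × Code₋₁ 0 k
    f (vertex i C) = inj₁ (i , C)
    f (edge i C)   = inj₂ (i , C)
    g : ∀ k → Fin (suc a⁻) × Code 0 k ⊎ Fin a⁻ × Code₋₁ 0 k → Code 1 k
    g k       (inj₁ (i , C)) = vertex i C
    g (suc k) (inj₂ (i , C)) = edge i C
    f∘g : ∀ k x → f (g k x) ≡ x
    f∘g k       (inj₁ _) = refl
    f∘g (suc k) (inj₂ _) = refl
    g∘f : ∀ {k} (C : Code 1 k) → g k (f C) ≡ C
    g∘f (vertex i C) = refl
    g∘f (edge i C)   = refl

  -- One summand for each constructor, in the order of the terms of the recurrence; the two that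
  -- contribute a pair lower the dimension.
  Code-2+ : ∀ n k → Code (2 + n) k ↔
    (((Fin (suc a⁻) × Code (1 + n) k ⊎ Fin b × Code n k)
      ⊎ Fin a⁻ × Code₋₁ (1 + n) k) ⊎ Fin b × Code₋₁ n k)
  Code-2+ n k = mk↔ₛ′ f (g k) (f∘g k) g∘f
    where
    Parts : ℕ → Set
    Parts k = ((Fin (suc a⁻) × Code (1 + n) k ⊎ Fin b × Code n k)
                ⊎ Fin a⁻ × Code₋₁ (1 + n) k) ⊎ Fin b × Code₋₁ n k
    f : ∀ {k} → Code (2 + n) k → Parts k
    f (vertex i C)  = inj₁ (inj₁ (inj₁ (i , C)))
    f (vertex₀ j C) = inj₁ (inj₁ (inj₂ (j , C)))
    f (edge i C)    = inj₁ (inj₂ (i , C))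
    f (edge₀ j C)   = inj₂ (j , C)
    g : ∀ k → Parts k → Code (2 + n) k
    g k       (inj₁ (inj₁ (inj₁ (i , C)))) = vertex i C
    g k       (inj₁ (inj₁ (inj₂ (j , C)))) = vertex₀ j C
    g (suc k) (inj₁ (inj₂ (i , C)))        = edge i C
    g (suc k) (inj₂ (j , C))               = edge₀ j C
    f∘g : ∀ k x → f (g k x) ≡ x
    f∘g k       (inj₁ (inj₁ (inj₁ _))) = refl
    f∘g k       (inj₁ (inj₁ (inj₂ _))) = refl
    f∘g (suc k) (inj₁ (inj₂ _))        = refl
    f∘g (suc k) (inj₂ _)               = refl
    g∘f : ∀ {k} (C : Code (2 + n) k) → g k (f C) ≡ C
    g∘f (vertex i C)  = refl
    g∘f (vertex₀ j C) = refl
    g∘f (edge i C)    = refl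
    g∘f (edge₀ j C)   = refl

  private
    infixl 5 _⊕_
    infixl 6 _·_
    _⊕_ : ∀ {A B : Set} {p q} → A ↔ Fin p → B ↔ Fin q → (A ⊎ B) ↔ Fin (p + q)
    F ⊕ G = ↔-sym Fin.+↔⊎ ↔-∘ (F ⊎-↔ G)

    _·_ : ∀ {A : Set} {q} p → A ↔ Fin q → (Fin p × A) ↔ Fin (p * q)
    p · F = ↔-sym Fin.*↔× ↔-∘ (↔-id (Fin p) ×-↔ F)

    size-unique : ∀ {A : Set} {p q} → A ↔ Fin p → A ↔ Fin q → p ≡ q
    size-unique F G = ↔⇒≡ (G ↔-∘ ↔-sym F)

  c₀≡s : ∀ n → c 0 (Π (suc a⁻) b n) ≡ s (suc a⁻) b n
  c₀≡s n = size-unique (Code↔Fin n 0) (Finite.index (𝒮-finite (suc a⁻) b n) ↔-∘ Code↔𝒮)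

  c-00 : c 0 (Π (suc a⁻) b 0) ≡ 1
  c-00 = size-unique (Code↔Fin 0 0) Code-00

  c-0suc : ∀ k → c (suc k) (Π (suc a⁻) b 0) ≡ 0
  c-0suc k = size-unique (Code↔Fin 0 (suc k)) Code-0suc

  c-1 : ∀ k → c k (Π (suc a⁻) b 1) ≡ suc a⁻ * c k (Π (suc a⁻) b 0) + a⁻ * c₋₁ k (Π (suc a⁻) b 0)
  c-1 k = size-unique (Code↔Fin 1 k) ((suc a⁻ · Code↔Fin 0 k ⊕ a⁻ · Code₋₁↔Fin 0 k) ↔-∘ Code-1 k)

  c-2+ : ∀ n k → c k (Π (suc a⁻) b (2 + n)) ≡
    suc a⁻ * c k (Π (suc a⁻) b (1 + n)) + b * c k (Π (suc a⁻) b n)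
    + a⁻ * c₋₁ k (Π (suc a⁻) b (1 + n)) + b * c₋₁ k (Π (suc a⁻) b n)
  c-2+ n k = size-unique (Code↔Fin (2 + n) k)
    ((suc a⁻ · Code↔Fin (1 + n) k ⊕ b · Code↔Fin n k
       ⊕ a⁻ · Code₋₁↔Fin (1 + n) k ⊕ b · Code₋₁↔Fin n k) ↔-∘ Code-2+ n k)

  c-11 : c 1 (Π (suc a⁻) b 1) ≡ a⁻
  c-11 = begin
    c 1 (Π (suc a⁻) b 1)
      ≡⟨ c-1 1 ⟩
    suc a⁻ * c 1 (Π (suc a⁻) b 0) + a⁻ * c 0 (Π (suc a⁻) b 0)
      ≡⟨ cong₂ (λ p q → suc a⁻ * p + a⁻ * q) (c-0suc 0) c-00 ⟩
    suc a⁻ * 0 + a⁻ * 1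
      ≡⟨ cong₂ _+_ (ℕ.*-zeroʳ (suc a⁻)) (ℕ.*-identityʳ a⁻) ⟩
    a⁻
      ∎
    where open ≡-Reasoning

-- Products of a power series with monomials

sum-zero : (t : Fin n → ℤ) → (∀ i → t i ≡ 0ℤ) → sum t ≡ 0ℤ
sum-zero {zero}  t t≡0 = refl
sum-zero {suc n} t t≡0 = cong₂ ℤ._+_ (t≡0 zero) (sum-zero (t ∘ suc) (t≡0 ∘ suc))

sum-single : (t : Fin n → ℤ) → ∀ i → (∀ j → j ≢ i → t j ≡ 0ℤ) → sum t ≡ t i
sum-single t zero    t≡0 = trans (cong (λ z → t zero ℤ.+ z) (sum-zero (t ∘ suc) λ j → t≡0 (suc j) λ ()))
  (ℤ.+-identityʳ (t zero))
sum-single t (suc i) t≡0 = trans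
  (cong₂ ℤ._+_ (t≡0 zero λ ()) (sum-single (t ∘ suc) i λ j j≢i → t≡0 (suc j) (j≢i ∘ Fin.suc-injective)))
  (ℤ.+-identityˡ (t (suc i)))

sum-minus : (t u : Fin n → ℤ) → sum (λ i → t i ℤ.- u i) ≡ sum t ℤ.- sum u
sum-minus {zero}  t u = refl
sum-minus {suc n} t u = trans (cong (λ z → t zero ℤ.- u zero ℤ.+ z) (sum-minus (t ∘ suc) (u ∘ suc)))
  (interchange (t zero) (u zero) (sum (t ∘ suc)) (sum (u ∘ suc)))
  where
  interchange : ∀ p q r s → p ℤ.- q ℤ.+ (r ℤ.- s) ≡ p ℤ.+ r ℤ.- (q ℤ.+ s)
  interchange = solve-∀

⊗-distribˡ-⊖ : ∀ f g h → f ⊗ (g ⊖ h) ≈ (f ⊗ g) ⊖ (f ⊗ h)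
⊗-distribˡ-⊖ f g h n k = trans
  (sum-cong-≗ {suc n} λ i → trans
    (sum-cong-≗ {suc k} λ j → distrib (f (toℕ i) (toℕ j)) (g (n ∸ toℕ i) (k ∸ toℕ j)) (h (n ∸ toℕ i) (k ∸ toℕ j)))
    (sum-minus {suc k} (term g i) (term h i)))
  (sum-minus {suc n} (λ i → sum (term g i)) (λ i → sum (term h i)))
  where
  term : Series → Fin (suc n) → Fin (suc k) → ℤ
  term g i j = f (toℕ i) (toℕ j) ℤ.* g (n ∸ toℕ i) (k ∸ toℕ j)
  distrib : ∀ p q r → p ℤ.* (q ℤ.- r) ≡ p ℤ.* q ℤ.- p ℤ.* r
  distrib = solve-∀

monomial-≡ : ∀ z p q → monomial z p q p q ≡ z
monomial-≡ z zero    zero    = refl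
monomial-≡ z zero    (suc q) = monomial-≡ z zero q
monomial-≡ z (suc p) q       = monomial-≡ z p q

monomial-≢ : ∀ z p q n k → n ≢ p ⊎ k ≢ q → monomial z p q n k ≡ 0ℤ
monomial-≢ z zero    zero    zero    zero    (inj₁ n≢p) = contradiction refl n≢p
monomial-≢ z zero    zero    zero    zero    (inj₂ k≢q) = contradiction refl k≢q
monomial-≢ z zero    zero    zero    (suc k) _          = refl
monomial-≢ z zero    zero    (suc n) k       _          = refl
monomial-≢ z zero    (suc q) zero    zero    _          = refl
monomial-≢ z zero    (suc q) zero    (suc k) (inj₁ n≢p) = contradiction refl n≢p
monomial-≢ z zero    (suc q) zero    (suc k) (inj₂ k≢q) = monomial-≢ z zero q zero k (inj₂ (k≢q ∘ cong suc))
monomial-≢ z zero    (suc q) (suc n) k       _          = refl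
monomial-≢ z (suc p) q       zero    k       _          = refl
monomial-≢ z (suc p) q       (suc n) k       ne         = monomial-≢ z p q n k (Sum.map₁ (_∘ cong suc) ne)

-- The only surviving term of the double sum has `i = n` and `j = k`, where the monomial is read at
-- its own exponents.
⊗-monomial : ∀ f z p q n k → (f ⊗ monomial z p q) (p + n) (q + k) ≡ f n k ℤ.* z
⊗-monomial f z p q n k = begin
  sum (λ i → sum (term i))        ≡⟨ sum-single (λ i → sum (term i)) i₀ (λ i i≢ →
                                       sum-zero (term i) λ j →
                                         off i j (inj₁ (misses p (Fin.toℕ≤pred[n] i) (i≢ ∘ at-i₀ i)))) ⟩
  sum (term i₀)                   ≡⟨ sum-single (term i₀) j₀ (λ j j≢ →
                                       off i₀ j (inj₂ (misses q (Fin.toℕ≤pred[n] j) (j≢ ∘ at-j₀ j)))) ⟩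
  term i₀ j₀                      ≡⟨ cong₂ (λ i j → f i j ℤ.* monomial z p q (p + n ∸ i) (q + k ∸ j)) i₀≡ j₀≡ ⟩
  f n k ℤ.* monomial z p q (p + n ∸ n) (q + k ∸ k)
    ≡⟨ cong₂ (λ i j → f n k ℤ.* monomial z p q i j) (ℕ.m+n∸n≡m p n) (ℕ.m+n∸n≡m q k) ⟩
  f n k ℤ.* monomial z p q p q    ≡⟨ cong (f n k ℤ.*_) (monomial-≡ z p q) ⟩
  f n k ℤ.* z                     ∎
  where
  open ≡-Reasoning
  term : Fin (suc (p + n)) → Fin (suc (q + k)) → ℤ
  term i j = f (toℕ i) (toℕ j) ℤ.* monomial z p q (p + n ∸ toℕ i) (q + k ∸ toℕ j)
  i₀ : Fin (suc (p + n))
  i₀ = fromℕ< (s≤s (ℕ.m≤n+m n p))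
  j₀ : Fin (suc (q + k))
  j₀ = fromℕ< (s≤s (ℕ.m≤n+m k q))
  i₀≡ : toℕ i₀ ≡ n
  i₀≡ = Fin.toℕ-fromℕ< _
  j₀≡ : toℕ j₀ ≡ k
  j₀≡ = Fin.toℕ-fromℕ< _
  at-i₀ : ∀ i → toℕ i ≡ n → i ≡ i₀
  at-i₀ i e = Fin.toℕ-injective (trans e (sym i₀≡))
  at-j₀ : ∀ j → toℕ j ≡ k → j ≡ j₀
  at-j₀ j e = Fin.toℕ-injective (trans e (sym j₀≡))
  -- The bound on `i` rules out truncation, which for `p = 0` would produce further hits.
  misses : ∀ p {n i} → i ≤ p + n → i ≢ n → p + n ∸ i ≢ p
  misses p i≤ i≢n e = i≢n (ℕ.+-cancelˡ-≡ p _ _ (trans (cong (_+ _) (sym e)) (ℕ.m∸n+n≡m i≤)))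
  off : ∀ i j → (p + n ∸ toℕ i ≢ p) ⊎ (q + k ∸ toℕ j ≢ q) → term i j ≡ 0ℤ
  off i j ne = trans (cong (f (toℕ i) (toℕ j) ℤ.*_) (monomial-≢ z p q _ _ ne)) (ℤ.*-zeroʳ (f (toℕ i) (toℕ j)))

-- The exponents at which the monomial is read never exceed `n` and `k`, so they miss `p` or `q`.
⊗-monomial-< : ∀ f z p q n k → n < p ⊎ k < q → (f ⊗ monomial z p q) n k ≡ 0ℤ
⊗-monomial-< f z p q n k lt = sum-zero {suc n} _ λ i → sum-zero {suc k} _ λ j → trans
  (cong (f (toℕ i) (toℕ j) ℤ.*_) (monomial-≢ z p q (n ∸ toℕ i) (k ∸ toℕ j)
    (Sum.map (λ n<p → ℕ.<⇒≢ (ℕ.≤-<-trans (ℕ.m∸n≤m n (toℕ i)) n<p))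
             (λ k<q → ℕ.<⇒≢ (ℕ.≤-<-trans (ℕ.m∸n≤m k (toℕ j)) k<q)) lt)))
  (ℤ.*-zeroʳ (f (toℕ i) (toℕ j)))

-- From the recurrence to the generating function

module Recurrence
  (a⁻ b : ℕ) (F F₋₁ : ℕ → ℕ → ℕ)
  (F₋₁-zero : ∀ n → F₋₁ n 0 ≡ 0)
  (F₋₁-suc  : ∀ n k → F₋₁ n (suc k) ≡ F n k)
  (F-00   : F 0 0 ≡ 1)
  (F-0suc : ∀ k → F 0 (suc k) ≡ 0)
  (F-1    : ∀ k → F 1 k ≡ suc a⁻ * F 0 k + a⁻ * F₋₁ 0 k)
  (F-2+   : ∀ n k → F (2 + n) k ≡ suc a⁻ * F (1 + n) k + b * F n k + a⁻ * F₋₁ (1 + n) k + b * F₋₁ n k)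
  where

  private
    a : ℕ
    a = suc a⁻

    A A₋₁ : Series
    A   n k = + F n k
    A₋₁ n k = + F₋₁ n k

  recurrence : ∀ n k → n ≥ 2 →
    F n k ≡ a * F (n ∸ 1) k + b * F (n ∸ 2) k + (a ∸ 1) * F₋₁ (n ∸ 1) k + b * F₋₁ (n ∸ 2) k
  recurrence (suc zero)    k (s≤s ())
  recurrence (suc (suc n)) k _ = F-2+ n k

  -- A factor `y` lowers the dimension by one; the convention for dimension -1 accounts for the
  -- vanishing coefficient at `k = 0`.
  shift-y : ∀ z p n k → (A ⊗ monomial z p 1) (p + n) k ≡ A₋₁ n k ℤ.* z
  shift-y z p n zero    = trans (⊗-monomial-< A z p 1 (p + n) 0 (inj₂ (s≤s z≤n)))
    (cong (λ t → + t ℤ.* z) (sym (F₋₁-zero n)))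
  shift-y z p n (suc k) = trans (⊗-monomial A z p 1 n k) (cong (λ t → + t ℤ.* z) (sym (F₋₁-suc n k)))

  expand : ∀ n k {t₀ t₁ t₂ t₃ t₄} →
    (A ⊗ one) n k                            ≡ t₀ →
    (A ⊗ monomial (+ a) 1 0) n k             ≡ t₁ →
    (A ⊗ monomial (+ b) 2 0) n k             ≡ t₂ →
    (A ⊗ monomial (+ a ℤ.- + 1) 1 1) n k     ≡ t₃ →
    (A ⊗ monomial (+ b) 2 1) n k             ≡ t₄ →
    (A ⊗ denominator a b) n k ≡ t₀ ℤ.- t₁ ℤ.- t₂ ℤ.- t₃ ℤ.- t₄
  expand n k e₀ e₁ e₂ e₃ e₄ =
    split (one ⊖ m₁ ⊖ m₂ ⊖ m₃) m₄
      (split (one ⊖ m₁ ⊖ m₂) m₃ (split (one ⊖ m₁) m₂ (split one m₁ e₀ e₁) e₂) e₃) e₄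
    where
    split : ∀ g h {t u} → (A ⊗ g) n k ≡ t → (A ⊗ h) n k ≡ u → (A ⊗ (g ⊖ h)) n k ≡ t ℤ.- u
    split g h e e′ = trans (⊗-distribˡ-⊖ A g h n k) (cong₂ ℤ._-_ e e′)
    m₁ m₂ m₃ m₄ : Series
    m₁ = monomial (+ a) 1 0
    m₂ = monomial (+ b) 2 0
    m₃ = monomial (+ a ℤ.- + 1) 1 1
    m₄ = monomial (+ b) 2 1

  minus-zeros : ∀ t → t ℤ.* 1ℤ ℤ.- 0ℤ ℤ.- 0ℤ ℤ.- 0ℤ ℤ.- 0ℤ ≡ t
  minus-zeros = solve-∀

  -- Compare coefficients of powers of `x`. For `n` equal to 0 or 1 the monomials of larger degree
  -- in `x` contribute nothing, and the initial values remain; from 2 on every monomial contributes,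
  -- and the recurrence cancels them all.
  generating : A ⊗ denominator a b ≈ one
  generating zero k = trans
    (expand 0 k (⊗-monomial A 1ℤ 0 0 0 k)
      (⊗-monomial-< A (+ a) 1 0 0 k (inj₁ (s≤s z≤n))) (⊗-monomial-< A (+ b) 2 0 0 k (inj₁ (s≤s z≤n)))
      -- The coefficient `+ a ℤ.- + 1` computes to `+ a⁻`, as `a` is `suc a⁻`.
      (⊗-monomial-< A (+ a⁻) 1 1 0 k (inj₁ (s≤s z≤n))) (⊗-monomial-< A (+ b) 2 1 0 k (inj₁ (s≤s z≤n))))
    (trans (minus-zeros (A 0 k)) (initial k))
    where
    initial : ∀ k → A 0 k ≡ one 0 k
    initial zero    = cong +_ F-00
    initial (suc k) = cong +_ (F-0suc k)
  generating (suc zero) k = trans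
    (expand 1 k (⊗-monomial A 1ℤ 0 0 1 k)
      (⊗-monomial A (+ a) 1 0 0 k) (⊗-monomial-< A (+ b) 2 0 1 k (inj₁ (s≤s (s≤s z≤n))))
      (shift-y (+ a⁻) 1 0 k) (⊗-monomial-< A (+ b) 2 1 1 k (inj₁ (s≤s (s≤s z≤n)))))
    (trans (cong (λ t → t ℤ.* 1ℤ ℤ.- A 0 k ℤ.* + a ℤ.- 0ℤ ℤ.- A₋₁ 0 k ℤ.* + a⁻ ℤ.- 0ℤ) rec)
      (cancel (+ a) (+ a⁻) (A 0 k) (A₋₁ 0 k)))
    where
    rec : A 1 k ≡ + a ℤ.* A 0 k ℤ.+ + a⁻ ℤ.* A₋₁ 0 k
    rec = trans (cong +_ (F-1 k)) (trans (ℤ.pos-+ (a * F 0 k) _) (cong₂ ℤ._+_ (ℤ.pos-* a _) (ℤ.pos-* a⁻ _)))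
    cancel : ∀ a a⁻ p q → (a ℤ.* p ℤ.+ a⁻ ℤ.* q) ℤ.* 1ℤ ℤ.- p ℤ.* a ℤ.- 0ℤ ℤ.- q ℤ.* a⁻ ℤ.- 0ℤ ≡ 0ℤ
    cancel = solve-∀
  generating (suc (suc n)) k = trans
    (expand (2 + n) k (⊗-monomial A 1ℤ 0 0 (2 + n) k)
      (⊗-monomial A (+ a) 1 0 (1 + n) k) (⊗-monomial A (+ b) 2 0 n k)
      (shift-y (+ a⁻) 1 (1 + n) k) (shift-y (+ b) 2 n k))
    (trans (cong (λ t → t ℤ.* 1ℤ ℤ.- A (1 + n) k ℤ.* + a ℤ.- A n k ℤ.* + b
                          ℤ.- A₋₁ (1 + n) k ℤ.* + a⁻ ℤ.- A₋₁ n k ℤ.* + b) rec)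
      (cancel (+ a) (+ a⁻) (+ b) (A (1 + n) k) (A n k) (A₋₁ (1 + n) k) (A₋₁ n k)))
    where
    rec : A (2 + n) k ≡ + a ℤ.* A (1 + n) k ℤ.+ + b ℤ.* A n k ℤ.+ + a⁻ ℤ.* A₋₁ (1 + n) k ℤ.+ + b ℤ.* A₋₁ n k
    rec = trans (cong +_ (F-2+ n k))
      (push (push (push (ℤ.pos-* a (F (1 + n) k)) (ℤ.pos-* b (F n k)))
                  (ℤ.pos-* a⁻ (F₋₁ (1 + n) k))) (ℤ.pos-* b (F₋₁ n k)))
      where
      push : ∀ {p q x y} → + p ≡ x → + q ≡ y → + (p + q) ≡ x ℤ.+ y
      push {p} {q} e e′ = trans (ℤ.pos-+ p q) (cong₂ ℤ._+_ e e′)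
    cancel : ∀ a a⁻ b p q r s → (a ℤ.* p ℤ.+ b ℤ.* q ℤ.+ a⁻ ℤ.* r ℤ.+ b ℤ.* s) ℤ.* 1ℤ
             ℤ.- p ℤ.* a ℤ.- q ℤ.* b ℤ.- r ℤ.* a⁻ ℤ.- s ℤ.* b ≡ 0ℤ
    cancel = solve-∀

theorem13 : (a b : ℕ) → a ≥ 1 → b ≥ 1 →
    ((n k : ℕ) → n ≥ 2 →
    c k (Π a b n) ≡ a * c k (Π a b (n ∸ 1)) + b * c k (Π a b (n ∸ 2))
    + (a ∸ 1) * c₋₁ k (Π a b (n ∸ 1)) + b * c₋₁ k (Π a b (n ∸ 2)))
    × ((n : ℕ) → c 0 (Π a b n) ≡ s a b n)
    × (c 1 (Π a b 1) ≡ a ∸ 1)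
    × (cubeSeries a b ⊗ denominator a b ≈ one)
-- `a ≥ 1` supplies the predecessor `a⁻`, the number of pairs of neighbours among the letters below
-- `a`.
theorem13 (suc a⁻) b _ _ = recurrence , c₀≡s , c-11 , generating
  where
  open Count a⁻ b
  open Recurrence a⁻ b (λ n k → c k (Π (suc a⁻) b n)) (λ n k → c₋₁ k (Π (suc a⁻) b n))
    (λ _ → refl) (λ _ _ → refl) c-00 c-0suc c-1 c-2+
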